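{- Each of the following three varieties has the finite embeddability property: the variety generated by all conservative residuated lattices; the variety generated by all commutative conservative residuated lattices; and the variety of semilinear idempotent residuated lattices.
   Context: A residuated lattice is an algebra $\mathbf A=\langle A,\wedge,\vee,\cdot,\backslash,/,\mathrm e\rangle$ such that $\langle A,\wedge,\vee\rangle$ is a lattice, $\langle A,\cdot,\mathrm e\rangle$ is a monoid, and for all $a,b,c\in A$: $b\le a\backslash c\iff a\cdot b\le c\iff a\le c/b$. It is idempotent if $aa=a$ for all $a$, commutative if $ab=ba$ for all $a,b$, and conservative if $ab\in\{a,b\}$ for all $a,b\in A$. The variety of semilinear idempotent residuated lattices is the variety generated by all totally ordered idempotent residuated lattices. A variety $\mathsf V$ has the finite embeddability property if for every $\mathbf A\in\mathsf V$ and every finite subset $B\subseteq A$, the partial subalgebra $\mathbf B$ of $\mathbf A$ on $B$ embeds into some finite $\mathbf D\in\mathsf V$, i.e., there is an injective map $h\colon B\to D$ such that for every basic operation $f$ and $b_1,\dots,b_k\in B$ with $f^{\mathbf A}(b_1,\dots,b_k)\in B$, $h(f^{\mathbf A}(b_1,\dots,b_k))=f^{\mathbf D}(h(b_1),\dots,h(b_k))$. -}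

module Defs where

open import Level using (Level; _⊔_; suc)
open import Algebra.Core using (Op₂)
open import Algebra.Definitions using (Commutative; Idempotent; Selective)
open import Algebra.Structures using (IsMonoid)
open import Algebra.Lattice.Structures using (IsLattice)
open import Data.Fin.Base using (Fin)
open import Data.List.Base using (List)
open import Data.Nat.Base using (ℕ)
open import Data.Product.Base using (∃; ∃-syntax; _×_; _,_; proj₁)
open import Function.Bundles using (_⇔_; Injection; Inverse)
open import Relation.Binary.Bundles using (Setoid)
open import Relation.Binary.Core using (Rel)
open import Relation.Binary.Definitions using (Total)
open import Relation.Binary.PropositionalEquality.Properties using (setoid)
open import Relation.Unary using (Pred)
import Data.List.Membership.Setoid as Membership
import Relation.Binary.Construct.NaturalOrder.Left as NaturalOrder
import Relation.Binary.Construct.On as On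

private
  variable
    c ℓ p : Level

-- a \\ b and a // b are the residuals written a\b and a/b.

record ResiduatedLattice c ℓ : Set (suc (c ⊔ ℓ)) where
  infix  4 _≈_
  infixr 7 _∧_
  infixr 6 _∨_
  infixl 8 _∙_
  infixr 8 _\\_
  infixl 8 _//_
  field
    Carrier   : Set c
    _≈_       : Rel Carrier ℓ
    _∧_       : Op₂ Carrier
    _∨_       : Op₂ Carrier
    _∙_       : Op₂ Carrier
    _\\_      : Op₂ Carrier
    _//_      : Op₂ Carrier
    e         : Carrier
    isLattice : IsLattice _≈_ _∨_ _∧_
    isMonoid  : IsMonoid _≈_ _∙_ e

  -- The lattice order: x ≤ y means x ≈ x ∧ y.
  open NaturalOrder _≈_ _∧_ public using (_≤_)

  field
    residualˡ : ∀ x y z → (y ≤ x \\ z) ⇔ (x ∙ y ≤ z)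
    residualʳ : ∀ x y z → (x ∙ y ≤ z) ⇔ (x ≤ z // y)

  carrierSetoid : Setoid c ℓ
  carrierSetoid = record { isEquivalence = IsLattice.isEquivalence isLattice }

data BinaryOp : Set where
  meet join mult under over : BinaryOp

⟦_⟧ᵒ : BinaryOp → (A : ResiduatedLattice c ℓ) → Op₂ (ResiduatedLattice.Carrier A)
⟦ meet  ⟧ᵒ A = ResiduatedLattice._∧_ A
⟦ join  ⟧ᵒ A = ResiduatedLattice._∨_ A
⟦ mult  ⟧ᵒ A = ResiduatedLattice._∙_ A
⟦ under ⟧ᵒ A = ResiduatedLattice._\\_ A
⟦ over  ⟧ᵒ A = ResiduatedLattice._//_ A

data Term : Set where
  var  : ℕ → Term
  unit : Term
  op   : BinaryOp → Term → Term → Term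

module _ (A : ResiduatedLattice c ℓ) where
  open ResiduatedLattice A

  ⟦_⟧ᵗ : Term → (ℕ → Carrier) → Carrier
  ⟦ var i    ⟧ᵗ ρ = ρ i
  ⟦ unit     ⟧ᵗ ρ = e
  ⟦ op f s t ⟧ᵗ ρ = ⟦ f ⟧ᵒ A (⟦ s ⟧ᵗ ρ) (⟦ t ⟧ᵗ ρ)

  Satisfies : Term → Term → Set (c ⊔ ℓ)
  Satisfies s t = ∀ ρ → ⟦ s ⟧ᵗ ρ ≈ ⟦ t ⟧ᵗ ρ

-- The smallest equational class containing K: the models of all equations
-- that are valid throughout K.

VarietyGeneratedBy : Pred (ResiduatedLattice c ℓ) p →
                     Pred (ResiduatedLattice c ℓ) (suc (c ⊔ ℓ) ⊔ p)
VarietyGeneratedBy K A =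
  ∀ s t → (∀ C → K C → Satisfies C s t) → Satisfies A s t

module _ (A : ResiduatedLattice c ℓ) where
  open ResiduatedLattice A

  IsIdempotent IsCommutative IsConservative IsTotallyOrdered : Set (c ⊔ ℓ)
  IsIdempotent     = Idempotent _≈_ _∙_
  IsCommutative    = Commutative _≈_ _∙_
  IsConservative   = Selective _≈_ _∙_
  IsTotallyOrdered = Total _≤_

  IsFinite : Set (c ⊔ ℓ)
  IsFinite = ∃[ n ] Inverse carrierSetoid (setoid (Fin n))

ConservativeVariety CommutativeConservativeVariety SemilinearIdempotentVariety :
  Pred (ResiduatedLattice c ℓ) (suc (c ⊔ ℓ))
ConservativeVariety =
  VarietyGeneratedBy IsConservative
CommutativeConservativeVariety =
  VarietyGeneratedBy (λ A → IsCommutative A × IsConservative A)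
SemilinearIdempotentVariety =
  VarietyGeneratedBy (λ A → IsTotallyOrdered A × IsIdempotent A)

-- A finite subset of A is given by a list B of its elements, membership being
-- up to ≈. As a setoid it consists of the elements of A that lie in B, compared
-- in A, so that the membership proof is irrelevant.

module _ (A : ResiduatedLattice c ℓ) (B : List (ResiduatedLattice.Carrier A)) where
  private module A = ResiduatedLattice A
  open Membership A.carrierSetoid using (_∈_)

  subsetSetoid : Setoid (c ⊔ ℓ) ℓ
  subsetSetoid = On.setoid {B = ∃ (_∈ B)} A.carrierSetoid proj₁

  record PartialEmbedding (D : ResiduatedLattice c ℓ) : Set (c ⊔ ℓ) where
    private module D = ResiduatedLattice D
    field
      injection : Injection subsetSetoid D.carrierSetoid

    open Injection injection renaming (to to h) public

    field
      preserves-e  : (e∈B : A.e ∈ B) → h (A.e , e∈B) D.≈ D.e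
      preserves-op : ∀ f x y (x∈B : x ∈ B) (y∈B : y ∈ B)
                     (fxy∈B : ⟦ f ⟧ᵒ A x y ∈ B) →
                     h (⟦ f ⟧ᵒ A x y , fxy∈B)
                       D.≈ ⟦ f ⟧ᵒ D (h (x , x∈B)) (h (y , y∈B))

FiniteEmbeddabilityProperty : Pred (ResiduatedLattice c ℓ) p →
                              Set (suc (c ⊔ ℓ) ⊔ p)
FiniteEmbeddabilityProperty V =
  ∀ A → V A → ∀ B → ∃[ D ] (V D × IsFinite D × PartialEmbedding A B D)

{-# OPTIONS --safe #-}

-- Let 𝒦 be one of the three generating classes; its members are conservative.
-- If C ∈ 𝒦 contains a finite set X ∋ e, then the joins of elements of X, with
-- a new bottom, are closed under multiplication and hence form a finite
-- residuated lattice in 𝒦 that keeps all operations of C defined inside X.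
--
-- To pass to the variety, let A satisfy the equations of 𝒦 and let B be a finite
-- subset. A term measures how far a valuation in C ∈ 𝒦 is from respecting the
-- partial operations of B. Its value q ≤ e can be lowered, by finitely many
-- conjugations that do not depend on C, to an idempotent r commuting with the
-- values of B, and the construction above works modulo r, where x is below y
-- if x r ≤ y. If no partial homomorphism g from B to a finite D ∈ 𝒦 has
-- g(a) ≰ g(b), then r ≤ a \ b is an equation of 𝒦, hence holds in A.
-- There r = e, so a ≤ b. A product of finitely many such D embeds B.

module Submission where

open import Level using (Level; Lift; lift; lower; _⊔_; suc)
open import Algebra.Core using (Op₂)
open import Algebra.Definitions using (Associative; Commutative; Identity; Selective)
open import Algebra.Lattice.Bundles using (Lattice)
open import Algebra.Lattice.Structures using (IsLattice)
open import Algebra.Structures using (IsMonoid)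
open import Axiom.ExcludedMiddle using (ExcludedMiddle)
open import Data.Empty.Polymorphic using () renaming (⊥ to Empty)
open import Data.Fin.Base as Fin using (Fin; toℕ)
open import Data.List.Base
  using (List; []; _∷_; _++_; allFin; cartesianProduct; cartesianProductWith;
         deduplicate; filter; foldr; length; lookup; map; tabulate)
open import Data.List.Membership.Propositional using (_∈_)
open import Data.List.Membership.Propositional.Properties
  using (∈-++⁺ˡ; ∈-++⁺ʳ; ∈-++⁻; ∈-allFin; ∈-cartesianProduct⁺; ∈-cartesianProductWith⁺;
         ∈-filter⁺; ∈-lookup; ∈-map⁺; ∈-map⁻; ∈-tabulate⁺)
open import Data.List.Relation.Unary.All as All using (All; []; _∷_)
open import Data.List.Relation.Unary.All.Properties using (all-filter)
open import Data.List.Relation.Unary.AllPairs using ([]; _∷_)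
open import Data.List.Relation.Unary.Any as Any using (here; there; index)
open import Data.List.Relation.Unary.Any.Properties using (lookup-index)
open import Data.List.Relation.Unary.Enumerates.Setoid using (IsEnumeration)
open import Data.Maybe.Base using (Maybe; just; nothing)
open import Data.Nat.Base using (ℕ)
open import Data.Product.Base as Product using (∃; ∃-syntax; _×_; _,_; proj₁; proj₂)
open import Data.Product.Function.NonDependent.Propositional using (_×-⇔_)
open import Data.Product.Relation.Binary.Pointwise.NonDependent
  using (Pointwise; ×-isEquivalence)
open import Data.Sum.Base as Sum using (_⊎_; inj₁; inj₂)
open import Data.Unit.Polymorphic using (⊤; tt)
open import Function.Base using (_∘_; const; id)
open import Function.Bundles using (_⇔_; Equivalence; mk⇔)
open import Function.Properties.Equivalence using ()
  renaming (sym to ⇔-sym; trans to ⇔-trans)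
open import Relation.Binary.Bundles using (Setoid; DecSetoid)
open import Relation.Binary.Core using (Rel; _Preserves₂_⟶_⟶_)
open import Relation.Binary.Definitions using (Minimum; Reflexive; Total; Transitive)
open import Relation.Binary.PropositionalEquality.Core as ≡ using (_≡_; refl; cong)
open import Relation.Nullary.Decidable using (Dec; yes; no; map′)
open import Relation.Nullary.Negation using (¬_; contradiction)
open import Relation.Unary using (Pred)
import Algebra.Lattice.Properties.Lattice as LatticeProperties
import Data.List.Membership.Setoid as Membership
import Data.List.Membership.Setoid.Properties as MembershipProperties
import Data.List.Relation.Unary.Enumerates.Setoid.Properties as Enumerates
import Data.List.Relation.Unary.Unique.DecSetoid.Properties as DecUnique
import Data.List.Relation.Unary.Unique.Setoid as Unique
import Relation.Binary.Lattice as Order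
import Relation.Binary.Lattice.Properties.JoinSemilattice as JoinSemilatticeProperties
import Relation.Binary.Lattice.Properties.Lattice as OrderLatticeProperties
import Relation.Binary.Reasoning.PartialOrder as PosetReasoning
open import Defs

private
  variable
    a b c ℓ : Level

-- Universe levels and elementary residuated lattice theory.

-- Excluded middle is assumed at one high level, while equality and order of elements are decided at
-- level `ℓ`.
lowerEM : ∀ b → ExcludedMiddle (a ⊔ b) → ExcludedMiddle a
lowerEM b em = map′ lower (lift {ℓ = b}) em

module ResiduatedLatticeProperties (A : ResiduatedLattice c ℓ) where
  open ResiduatedLattice A

  lattice : Lattice c ℓ
  lattice = record { isLattice = isLattice }

  open LatticeProperties lattice public using (poset; ∨-∧-isOrderTheoreticLattice)

  open Order.IsLattice ∨-∧-isOrderTheoreticLattice public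
    using (x≤x∨y; y≤x∨y; ∨-least; x∧y≤x; x∧y≤y; ∧-greatest; reflexive; antisym)
    renaming (refl to ≤-refl; trans to ≤-trans; module Eq to ≈)

  open IsLattice isLattice public using (∨-cong; ∧-cong)
  open IsMonoid isMonoid public
    using (∙-cong; ∙-congˡ; ∙-congʳ; assoc; identityˡ; identityʳ)

  open PosetReasoning poset

  under-intro : ∀ {x y z} → x ∙ y ≤ z → y ≤ x \\ z
  under-intro = Equivalence.from (residualˡ _ _ _)

  under-elim : ∀ {x y z} → y ≤ x \\ z → x ∙ y ≤ z
  under-elim = Equivalence.to (residualˡ _ _ _)

  over-intro : ∀ {x y z} → x ∙ y ≤ z → x ≤ z // y
  over-intro = Equivalence.to (residualʳ _ _ _)

  over-elim : ∀ {x y z} → x ≤ z // y → x ∙ y ≤ z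
  over-elim = Equivalence.from (residualʳ _ _ _)

  ∙-monoʳ : ∀ x {y z} → y ≤ z → x ∙ y ≤ x ∙ z
  ∙-monoʳ x y≤z = under-elim (≤-trans y≤z (under-intro ≤-refl))

  ∙-monoˡ : ∀ x {y z} → y ≤ z → y ∙ x ≤ z ∙ x
  ∙-monoˡ x y≤z = over-elim (≤-trans y≤z (over-intro ≤-refl))

  ∙-mono : ∀ {x y u v} → x ≤ y → u ≤ v → x ∙ u ≤ y ∙ v
  ∙-mono x≤y u≤v = ≤-trans (∙-monoˡ _ x≤y) (∙-monoʳ _ u≤v)

  -- Multiplication by `x` on the left has a right adjoint and therefore preserves joins.
  ∙-distribˡ-∨-≤ : ∀ x y z → x ∙ (y ∨ z) ≤ x ∙ y ∨ x ∙ z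
  ∙-distribˡ-∨-≤ x y z =
    under-elim (∨-least (under-intro (x≤x∨y _ _)) (under-intro (y≤x∨y _ _)))

  ∙-distribʳ-∨-≤ : ∀ x y z → (y ∨ z) ∙ x ≤ y ∙ x ∨ z ∙ x
  ∙-distribʳ-∨-≤ x y z =
    over-elim (∨-least (over-intro (x≤x∨y _ _)) (over-intro (y≤x∨y _ _)))

  x≤e⇒y∙x≤y : ∀ {x} y → x ≤ e → y ∙ x ≤ y
  x≤e⇒y∙x≤y y x≤e = ≤-trans (∙-monoʳ y x≤e) (reflexive (identityʳ y))

  x≤e⇒x∙y≤y : ∀ {x} y → x ≤ e → x ∙ y ≤ y
  x≤e⇒x∙y≤y y x≤e = ≤-trans (∙-monoˡ y x≤e) (reflexive (identityˡ y))

  conservative⇒idempotent : IsConservative A → IsIdempotent A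
  conservative⇒idempotent sel x = Sum.[ id , id ] (sel x x)

  -- For x ≤ y put z = xy, so that x ≤ z ≤ y and xz = z = zy; then z = y if
  -- e ≤ z and z = x if z ≤ e.
  totallyOrdered∧idempotent⇒conservative :
    IsTotallyOrdered A → IsIdempotent A → IsConservative A
  totallyOrdered∧idempotent⇒conservative total idem x y
    with total x y | total e (x ∙ y)
  ... | inj₁ x≤y | inj₁ e≤xy = inj₂ (antisym
    (begin x ∙ y ≤⟨ ∙-monoˡ y x≤y ⟩ y ∙ y ≈⟨ idem y ⟩ y ∎)
    (begin
      y           ≈⟨ identityˡ y ⟨
      e ∙ y       ≤⟨ ∙-monoˡ y e≤xy ⟩
      x ∙ y ∙ y   ≈⟨ assoc x y y ⟩
      x ∙ (y ∙ y) ≈⟨ ∙-congˡ (idem y) ⟩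
      x ∙ y       ∎))
  ... | inj₁ x≤y | inj₂ xy≤e = inj₁ (antisym
    (begin
      x ∙ y       ≈⟨ ∙-congʳ (idem x) ⟨
      x ∙ x ∙ y   ≈⟨ assoc x x y ⟩
      x ∙ (x ∙ y) ≤⟨ x≤e⇒y∙x≤y x xy≤e ⟩
      x           ∎)
    (begin x ≈⟨ idem x ⟨ x ∙ x ≤⟨ ∙-monoʳ x x≤y ⟩ x ∙ y ∎))
  ... | inj₂ y≤x | inj₁ e≤xy = inj₁ (antisym
    (begin x ∙ y ≤⟨ ∙-monoʳ x y≤x ⟩ x ∙ x ≈⟨ idem x ⟩ x ∎)
    (begin
      x           ≈⟨ identityʳ x ⟨
      x ∙ e       ≤⟨ ∙-monoʳ x e≤xy ⟩
      x ∙ (x ∙ y) ≈⟨ assoc x x y ⟨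
      x ∙ x ∙ y   ≈⟨ ∙-congʳ (idem x) ⟩
      x ∙ y       ∎))
  ... | inj₂ y≤x | inj₂ xy≤e = inj₂ (antisym
    (begin
      x ∙ y       ≈⟨ ∙-congˡ (idem y) ⟨
      x ∙ (y ∙ y) ≈⟨ assoc x y y ⟨
      x ∙ y ∙ y   ≤⟨ x≤e⇒x∙y≤y y xy≤e ⟩
      y           ∎)
    (begin y ≈⟨ idem y ⟨ y ∙ y ≤⟨ ∙-monoˡ y y≤x ⟩ x ∙ y ∎))

-- Finite products.

-- The empty product, where the induction that builds finite products starts.
trivial : ResiduatedLattice c ℓ
trivial = record
  { Carrier = ⊤
  ; _≈_ = λ _ _ → ⊤
  ; _∧_ = _
  ; _∨_ = _
  ; _∙_ = _
  ; _\\_ = _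
  ; _//_ = _
  ; e = _
  ; isLattice = _
  ; isMonoid = _
  ; residualˡ = λ _ _ _ → mk⇔ _ _
  ; residualʳ = λ _ _ _ → mk⇔ _ _
  }

infixr 2 _×ᴿ_

_×ᴿ_ : ResiduatedLattice c ℓ → ResiduatedLattice c ℓ → ResiduatedLattice c ℓ
A ×ᴿ B = record
  { Carrier = A.Carrier × B.Carrier
  ; _≈_ = Pointwise A._≈_ B._≈_
  ; _∧_ = Product.zip A._∧_ B._∧_
  ; _∨_ = Product.zip A._∨_ B._∨_
  ; _∙_ = Product.zip A._∙_ B._∙_
  ; _\\_ = Product.zip A._\\_ B._\\_
  ; _//_ = Product.zip A._//_ B._//_
  ; e = A.e , B.e
  ; isLattice = record
    { isEquivalence = isEquivalence
    ; ∨-comm = λ (x , u) (y , v) → AL.∨-comm x y , BL.∨-comm u v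
    ; ∨-assoc = λ (x , u) (y , v) (z , w) → AL.∨-assoc x y z , BL.∨-assoc u v w
    ; ∨-cong = Product.zip AL.∨-cong BL.∨-cong
    ; ∧-comm = λ (x , u) (y , v) → AL.∧-comm x y , BL.∧-comm u v
    ; ∧-assoc = λ (x , u) (y , v) (z , w) → AL.∧-assoc x y z , BL.∧-assoc u v w
    ; ∧-cong = Product.zip AL.∧-cong BL.∧-cong
    ; absorptive =
        (λ (x , u) (y , v) → AL.∨-absorbs-∧ x y , BL.∨-absorbs-∧ u v) ,
        (λ (x , u) (y , v) → AL.∧-absorbs-∨ x y , BL.∧-absorbs-∨ u v)
    }
  ; isMonoid = record
    { isSemigroup = record
      { isMagma = record
        { isEquivalence = isEquivalence
        ; ∙-cong = Product.zip AM.∙-cong BM.∙-cong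
        }
      ; assoc = λ (x , u) (y , v) (z , w) → AM.assoc x y z , BM.assoc u v w
      }
    ; identity =
        (λ (x , u) → AM.identityˡ x , BM.identityˡ u) ,
        (λ (x , u) → AM.identityʳ x , BM.identityʳ u)
    }
  ; residualˡ = λ (x , u) (y , v) (z , w) → mk⇔
      (Product.map (to (A.residualˡ x y z)) (to (B.residualˡ u v w)))
      (Product.map (from (A.residualˡ x y z)) (from (B.residualˡ u v w)))
  ; residualʳ = λ (x , u) (y , v) (z , w) → mk⇔
      (Product.map (to (A.residualʳ x y z)) (to (B.residualʳ u v w)))
      (Product.map (from (A.residualʳ x y z)) (from (B.residualʳ u v w)))
  }
  where
  open Equivalence using (to; from)
  module A = ResiduatedLattice A
  module B = ResiduatedLattice B
  module AL = IsLattice A.isLattice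
  module BL = IsLattice B.isLattice
  module AM = IsMonoid A.isMonoid
  module BM = IsMonoid B.isMonoid
  isEquivalence = ×-isEquivalence AL.isEquivalence BL.isEquivalence

module _ (A B : ResiduatedLattice c ℓ) where

  -- True by definition for each operation, but `⟦ f ⟧ᵒ` reduces only once `f` is a constructor.
  ×ᴿ-⟦⟧ᵒ : ∀ f x y → ⟦ f ⟧ᵒ (A ×ᴿ B) x y ≡
           (⟦ f ⟧ᵒ A (proj₁ x) (proj₁ y) , ⟦ f ⟧ᵒ B (proj₂ x) (proj₂ y))
  ×ᴿ-⟦⟧ᵒ meet  _ _ = refl
  ×ᴿ-⟦⟧ᵒ join  _ _ = refl
  ×ᴿ-⟦⟧ᵒ mult  _ _ = refl
  ×ᴿ-⟦⟧ᵒ under _ _ = refl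
  ×ᴿ-⟦⟧ᵒ over  _ _ = refl

  ×ᴿ-⟦⟧ᵗ : ∀ t ρ → ⟦_⟧ᵗ (A ×ᴿ B) t ρ ≡
           (⟦_⟧ᵗ A t (proj₁ ∘ ρ) , ⟦_⟧ᵗ B t (proj₂ ∘ ρ))
  ×ᴿ-⟦⟧ᵗ (var i) ρ = refl
  ×ᴿ-⟦⟧ᵗ unit ρ = refl
  ×ᴿ-⟦⟧ᵗ (op f s t) ρ
    rewrite ×ᴿ-⟦⟧ᵒ f (⟦_⟧ᵗ (A ×ᴿ B) s ρ) (⟦_⟧ᵗ (A ×ᴿ B) t ρ)
          | ×ᴿ-⟦⟧ᵗ s ρ | ×ᴿ-⟦⟧ᵗ t ρ = refl

  ×ᴿ-satisfies : ∀ s t → Satisfies A s t → Satisfies B s t → Satisfies (A ×ᴿ B) s t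
  ×ᴿ-satisfies s t sat-A sat-B ρ
    rewrite ×ᴿ-⟦⟧ᵗ s ρ | ×ᴿ-⟦⟧ᵗ t ρ = sat-A (proj₁ ∘ ρ) , sat-B (proj₂ ∘ ρ)

-- Finiteness from enumerations.

module _ (S : Setoid a ℓ) where
  open Setoid S using (_≈_; sym)
  open Unique S using (Unique)

  lookup-injective : ∀ {xs} → Unique xs → ∀ {i j} → lookup xs i ≈ lookup xs j → i ≡ j
  lookup-injective (_ ∷ _) {Fin.zero} {Fin.zero} _ = refl
  lookup-injective {x ∷ xs} (x∉ ∷ _) {Fin.zero} {Fin.suc j} eq =
    contradiction eq (All.lookup x∉ (∈-lookup j))
  lookup-injective {x ∷ xs} (x∉ ∷ _) {Fin.suc i} {Fin.zero} eq =
    contradiction (sym eq) (All.lookup x∉ (∈-lookup i))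
  lookup-injective (_ ∷ u) {Fin.suc i} {Fin.suc j} eq = cong Fin.suc (lookup-injective u eq)

-- Finiteness with repetitions allowed, which is easier to carry through products and quotients than
-- a bijection with `Fin n`.
HasEnumeration : ResiduatedLattice c ℓ → Set (c ⊔ ℓ)
HasEnumeration A = ∃[ xs ] IsEnumeration (ResiduatedLattice.carrierSetoid A) xs

×ᴿ-hasEnumeration : (A B : ResiduatedLattice c ℓ) →
                    HasEnumeration A → HasEnumeration B → HasEnumeration (A ×ᴿ B)
×ᴿ-hasEnumeration A B (xs , ∈xs) (ys , ∈ys) =
  cartesianProduct xs ys ,
  Enumerates.cartesianProduct⁺ (ResiduatedLattice.carrierSetoid A)
    (ResiduatedLattice.carrierSetoid B) ∈xs ∈ys

-- Excluded middle decides equality, so repetitions can be deleted; the position in the remaining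
-- list is then a bijection.
hasEnumeration⇒finite : ExcludedMiddle ℓ → (A : ResiduatedLattice c ℓ) →
                        HasEnumeration A → IsFinite A
hasEnumeration⇒finite em A (xs , ∈xs) = length ys , record
  { to = index ∘ ∈ys
  ; from = lookup ys
  ; to-cong = λ {x} {y} x≈y → lookup-injective S unique
      (trans (sym (lookup-index (∈ys x))) (trans x≈y (lookup-index (∈ys y))))
  ; from-cong = λ { refl → Setoid.refl S }
  ; inverse =
      (λ {i} {x} x≈ → lookup-injective S unique (trans (sym (lookup-index (∈ys x))) x≈)) ,
      (λ { {x} refl → sym (lookup-index (∈ys x)) })
  }
  where
  S = ResiduatedLattice.carrierSetoid A
  open Setoid S using (sym; trans; _≈_)
  S? : DecSetoid _ _
  S? = record
    { isDecEquivalence = record { isEquivalence = Setoid.isEquivalence S ; _≟_ = λ _ _ → em } }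
  ys = deduplicate (DecSetoid._≟_ S?) xs
  ∈ys = Enumerates.deduplicate⁺ S? ∈xs
  unique = DecUnique.deduplicate-! S? xs

-- Join-monoids and represented operations.

-- The order is only a preorder and _≈_ is the equivalence it induces, so that
-- quotients need no new carrier.
record JoinMonoid c ℓ : Set (suc (c ⊔ ℓ)) where
  infix  4 _≲_ _≈_
  infixr 6 _∨_
  infixl 8 _∙_
  field
    Carrier : Set c
    _≲_     : Rel Carrier ℓ
    _∨_     : Op₂ Carrier
    _∙_     : Op₂ Carrier
    ⊥       : Carrier
    e       : Carrier

  _≈_ : Rel Carrier ℓ
  x ≈ y = x ≲ y × y ≲ x

  field
    ≲-refl       : Reflexive _≲_
    ≲-trans      : Transitive _≲_
    minimum      : Minimum _≲_ ⊥
    supremum     : Order.Supremum _≲_ _∨_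
    ∙-mono       : _∙_ Preserves₂ _≲_ ⟶ _≲_ ⟶ _≲_
    assoc        : Associative _≈_ _∙_
    identity     : Identity _≈_ e _∙_
    zeroˡ        : ∀ x → ⊥ ∙ x ≲ ⊥
    zeroʳ        : ∀ x → x ∙ ⊥ ≲ ⊥
    ∙-distribˡ-∨ : ∀ x y z → x ∙ (y ∨ z) ≲ x ∙ y ∨ x ∙ z
    ∙-distribʳ-∨ : ∀ x y z → (y ∨ z) ∙ x ≲ y ∙ x ∨ z ∙ x

  joinSemilattice : Order.JoinSemilattice c ℓ ℓ
  joinSemilattice = record
    { _≈_ = _≈_
    ; isJoinSemilattice = record
      { isPartialOrder = record
        { isPreorder = record
          { isEquivalence = record
            { refl = ≲-refl , ≲-refl
            ; sym = Product.swap
            ; trans = Product.zip ≲-trans (λ y≲x z≲y → ≲-trans z≲y y≲x)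
            }
          ; reflexive = proj₁
          ; trans = ≲-trans
          }
        ; antisym = _,_
        }
      ; supremum = supremum
      }
    }

  open Order.JoinSemilattice joinSemilattice public
    using (poset; isPartialOrder; isEquivalence; x≤x∨y; y≤x∨y; ∨-least)
    renaming (module Eq to ≈)

  open JoinSemilatticeProperties joinSemilattice public
    using (∨-cong; ∨-assoc; ∨-comm; ∨-idempotent)

  setoid : Setoid c ℓ
  setoid = record { isEquivalence = isEquivalence }

  ∙-cong : _∙_ Preserves₂ _≈_ ⟶ _≈_ ⟶ _≈_
  ∙-cong = Product.zip ∙-mono ∙-mono

  ⋁ : List Carrier → Carrier
  ⋁ = foldr _∨_ ⊥

  open Membership setoid using () renaming (_∈_ to _∈ˢ_)

  ⋁-upper : ∀ {x xs} → x ∈ˢ xs → x ≲ ⋁ xs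
  ⋁-upper (here x≈y) = ≲-trans (proj₁ x≈y) (x≤x∨y _ _)
  ⋁-upper (there x∈xs) = ≲-trans (⋁-upper x∈xs) (y≤x∨y _ _)

  private
    ≲-cong : ∀ {x x′ y y′} → x ≈ x′ → y ≈ y′ → x ≲ y ⇔ x′ ≲ y′
    ≲-cong (x≲x′ , x′≲x) (y≲y′ , y′≲y) = mk⇔
      (λ x≲y → ≲-trans x′≲x (≲-trans x≲y y≲y′))
      (λ x′≲y′ → ≲-trans x≲x′ (≲-trans x′≲y′ y′≲y))

  -- x is the value of f at a and b, expressed without assuming that meets
  -- and residuals exist in general.
  Represents : BinaryOp → (a b x : Carrier) → Set (c ⊔ ℓ)
  Represents meet  a b x = ∀ y → (y ≲ a × y ≲ b) ⇔ y ≲ x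
  Represents join  a b x = ∀ y → (a ≲ y × b ≲ y) ⇔ x ≲ y
  Represents mult  a b x = ∀ y → a ∙ b ≲ y ⇔ x ≲ y
  Represents under a b x = ∀ y → a ∙ y ≲ b ⇔ y ≲ x
  Represents over  a b x = ∀ y → y ∙ b ≲ a ⇔ y ≲ x

  represents-resp-≈ : ∀ f {a a′ b b′ x x′} → a ≈ a′ → b ≈ b′ → x ≈ x′ →
                      Represents f a b x → Represents f a′ b′ x′
  represents-resp-≈ meet a≈ b≈ x≈ rep y =
    ⇔-trans (⇔-sym (≲-cong ≈.refl a≈ ×-⇔ ≲-cong ≈.refl b≈)) (⇔-trans (rep y) (≲-cong ≈.refl x≈))
  represents-resp-≈ join a≈ b≈ x≈ rep y =
    ⇔-trans (⇔-sym (≲-cong a≈ ≈.refl ×-⇔ ≲-cong b≈ ≈.refl)) (⇔-trans (rep y) (≲-cong x≈ ≈.refl))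
  represents-resp-≈ mult a≈ b≈ x≈ rep y =
    ⇔-trans (⇔-sym (≲-cong (∙-cong a≈ b≈) ≈.refl)) (⇔-trans (rep y) (≲-cong x≈ ≈.refl))
  represents-resp-≈ under a≈ b≈ x≈ rep y =
    ⇔-trans (⇔-sym (≲-cong (∙-cong a≈ ≈.refl) b≈)) (⇔-trans (rep y) (≲-cong ≈.refl x≈))
  represents-resp-≈ over a≈ b≈ x≈ rep y =
    ⇔-trans (⇔-sym (≲-cong (∙-cong ≈.refl b≈) a≈)) (⇔-trans (rep y) (≲-cong ≈.refl x≈))

-- Finite join-monoids as residuated lattices.

module _ {c ℓ} (M : JoinMonoid c ℓ) where
  open JoinMonoid M

  module FiniteJoinMonoid (em : ExcludedMiddle ℓ)
    (elements : List Carrier) (∈elements : IsEnumeration setoid elements) where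

    -- In a finite join-monoid every ideal is principal, with generator `sup P`. Meets and residuals
    -- are obtained as generators of suitable ideals.
    record IsIdeal (P : Pred Carrier ℓ) : Set (c ⊔ ℓ) where
      field
        ≲-closed : ∀ {x y} → x ≲ y → P y → P x
        ⊥-closed : P ⊥
        ∨-closed : ∀ {x y} → P x → P y → P (x ∨ y)

    open IsIdeal

    sup : Pred Carrier ℓ → Carrier
    sup P = ⋁ (filter {P = P} (λ _ → em) elements)

    module _ {P : Pred Carrier ℓ} (ideal : IsIdeal P) where

      sup-upper : ∀ {x} → P x → x ≲ sup P
      sup-upper Px = ⋁-upper
        -- The list contains `x` only up to `_≈_`; being closed downwards, an ideal respects `_≈_`.
        (MembershipProperties.∈-filter⁺ setoid _ (λ x≈y → ≲-closed ideal (proj₂ x≈y)) (∈elements _) Px)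

      sup-member : P (sup P)
      sup-member = go (all-filter _ elements)
        where
        go : ∀ {xs} → All P xs → P (⋁ xs)
        go [] = ⊥-closed ideal
        go (Px ∷ Pxs) = ∨-closed ideal Px (go Pxs)

      -- The hypothesis has the shape of `Represents` for meets and residuals: `x` generates the
      -- ideal `P`.
      sup-unique : ∀ {x} → (∀ y → P y ⇔ y ≲ x) → sup P ≈ x
      sup-unique P⇔ =
        Equivalence.to (P⇔ _) sup-member , sup-upper (Equivalence.from (P⇔ _) ≲-refl)

    meet-ideal : ∀ x y → IsIdeal (λ z → z ≲ x × z ≲ y)
    meet-ideal x y = record
      { ≲-closed = λ z≲w → Product.map (≲-trans z≲w) (≲-trans z≲w)
      ; ⊥-closed = minimum x , minimum y
      ; ∨-closed = Product.zip ∨-least ∨-least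
      }

    -- Closure under finite joins, the empty one included, is where distributivity and the zero laws
    -- enter.
    under-ideal : ∀ x y → IsIdeal (λ z → x ∙ z ≲ y)
    under-ideal x y = record
      { ≲-closed = λ z≲w → ≲-trans (∙-mono ≲-refl z≲w)
      ; ⊥-closed = ≲-trans (zeroʳ x) (minimum y)
      ; ∨-closed = λ xz≲y xw≲y → ≲-trans (∙-distribˡ-∨ x _ _) (∨-least xz≲y xw≲y)
      }

    over-ideal : ∀ x y → IsIdeal (λ z → z ∙ x ≲ y)
    over-ideal x y = record
      { ≲-closed = λ z≲w → ≲-trans (∙-mono z≲w ≲-refl)
      ; ⊥-closed = ≲-trans (zeroˡ x) (minimum y)
      ; ∨-closed = λ zx≲y wx≲y → ≲-trans (∙-distribʳ-∨ x _ _) (∨-least zx≲y wx≲y)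
      }

    infixr 7 _∧_
    infixr 8 _\\_
    infixl 8 _//_

    _∧_ _\\_ _//_ : Op₂ Carrier
    x ∧ y = sup (λ z → z ≲ x × z ≲ y)
    x \\ y = sup (λ z → x ∙ z ≲ y)
    x // y = sup (λ z → z ∙ y ≲ x)

    -- A `ResiduatedLattice` reads its order off the meet, whereas `_≲_` is given in advance; the
    -- residuation laws are transported along this equivalence.
    ≲⇔natural : ∀ {x y} → x ≲ y ⇔ x ≈ x ∧ y
    ≲⇔natural {x} {y} = mk⇔
      (λ x≲y → sup-upper (meet-ideal x y) (≲-refl , x≲y) , proj₁ (sup-member (meet-ideal x y)))
      (λ x≈x∧y → ≲-trans (proj₁ x≈x∧y) (proj₂ (sup-member (meet-ideal x y))))

    residuatedLattice : ResiduatedLattice c ℓ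
    residuatedLattice = record
      { Carrier = Carrier
      ; _≈_ = _≈_
      ; _∧_ = _∧_
      ; _∨_ = _∨_
      ; _∙_ = _∙_
      ; _\\_ = _\\_
      ; _//_ = _//_
      ; e = e
      ; isLattice = OrderLatticeProperties.isAlgLattice (record
        { isLattice = record
          { isPartialOrder = isPartialOrder
          ; supremum = supremum
          ; infimum = λ x y →
              proj₁ (sup-member (meet-ideal x y)) ,
              proj₂ (sup-member (meet-ideal x y)) ,
              λ _ z≲x z≲y → sup-upper (meet-ideal x y) (z≲x , z≲y)
          }
        })
      ; isMonoid = record
        { isSemigroup = record
          { isMagma = record { isEquivalence = isEquivalence ; ∙-cong = ∙-cong }
          ; assoc = assoc
          }
        ; identity = identity
        }
      ; residualˡ = λ x y z → mk⇔
          (λ y≤ → to ≲⇔natural (≲-closed (under-ideal x z) (from ≲⇔natural y≤)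
                                     (sup-member (under-ideal x z))))
          (λ xy≤z → to ≲⇔natural (sup-upper (under-ideal x z) (from ≲⇔natural xy≤z)))
      ; residualʳ = λ x y z → mk⇔
          (λ xy≤z → to ≲⇔natural (sup-upper (over-ideal y z) (from ≲⇔natural xy≤z)))
          (λ x≤ → to ≲⇔natural (≲-closed (over-ideal y z) (from ≲⇔natural x≤)
                                     (sup-member (over-ideal y z))))
      }
      where open Equivalence using (to; from)

    residuatedLattice-total : Total _≲_ → IsTotallyOrdered residuatedLattice
    residuatedLattice-total total x y =
      Sum.map (Equivalence.to ≲⇔natural) (Equivalence.to ≲⇔natural) (total x y)

    represents⇒≈ : ∀ f {x y z} → Represents f x y z → ⟦ f ⟧ᵒ residuatedLattice x y ≈ z
    represents⇒≈ meet {x} {y} rep = sup-unique (meet-ideal x y) rep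
    represents⇒≈ join rep =
      let x≲z , y≲z = Equivalence.from (rep _) ≲-refl in
      ∨-least x≲z y≲z , Equivalence.to (rep _) (x≤x∨y _ _ , y≤x∨y _ _)
    represents⇒≈ mult rep = Equivalence.from (rep _) ≲-refl , Equivalence.to (rep _) ≲-refl
    represents⇒≈ under {x} {y} rep = sup-unique (under-ideal x y) rep
    represents⇒≈ over {x} {y} rep = sup-unique (over-ideal y x) rep

-- The finite join-monoid of joins of generators.

module _ {I : Set c} where

  subs : List I → List (List I)
  subs [] = [] ∷ []
  subs (i ∷ is) = subs is ++ map (i ∷_) (subs is)

  []∈subs : ∀ is → [] ∈ subs is
  []∈subs [] = here refl
  []∈subs (i ∷ is) = ∈-++⁺ˡ ([]∈subs is)

-- In a conservative join-monoid the joins of any set of generators containing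
-- the unit are closed under multiplication.
module _ {b ℓ} (M : JoinMonoid b ℓ) where
  open JoinMonoid M

  module Generated {c} (selective : Selective _≈_ _∙_)
    {I : Set c} (g : I → Carrier) (u : I) (gu≈e : g u ≈ e) where

    open PosetReasoning poset

    -- Elements are named by lists of generators and compared through `val`, so lists with the same
    -- join become equal.
    val : List I → Carrier
    val = foldr (λ i → g i ∨_) ⊥

    val-[_] : ∀ i → val (i ∷ []) ≈ g i
    val-[ i ] = ∨-least ≲-refl (minimum _) , x≤x∨y _ _

    val-++ : ∀ s t → val (s ++ t) ≈ val s ∨ val t
    val-++ [] t = y≤x∨y _ _ , ∨-least (minimum _) ≲-refl
    val-++ (i ∷ s) t = ≈.trans (∨-cong ≈.refl (val-++ s t)) (≈.sym (∨-assoc _ _ _))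

    -- By conservativity the product of two joins is one of them, so a list naming it is at hand.
    -- The choice is made on lists, but up to `_≈_` it depends only on their values.
    _⊙_ : Op₂ (List I)
    s ⊙ t = Sum.[ const s , const t ] (selective (val s) (val t))

    val-⊙ : ∀ s t → val (s ⊙ t) ≈ val s ∙ val t
    val-⊙ s t with selective (val s) (val t)
    ... | inj₁ eq = ≈.sym eq
    ... | inj₂ eq = ≈.sym eq

    val-e : val (u ∷ []) ≈ e
    val-e = ≈.trans val-[ u ] gu≈e

    generated : JoinMonoid c ℓ
    generated = record
      { Carrier = List I
      ; _≲_ = λ s t → val s ≲ val t
      ; _∨_ = _++_
      ; _∙_ = _⊙_
      ; ⊥ = []
      ; e = u ∷ []
      ; ≲-refl = ≲-refl
      ; ≲-trans = ≲-trans
      ; minimum = λ s → minimum (val s)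
      ; supremum = λ s t →
          ≲-trans (x≤x∨y _ _) (proj₂ (val-++ s t)) ,
          ≲-trans (y≤x∨y _ _) (proj₂ (val-++ s t)) ,
          λ _ s≲ t≲ → ≲-trans (proj₁ (val-++ s t)) (∨-least s≲ t≲)
      ; ∙-mono = λ {s} {s′} {t} {t′} s≲s′ t≲t′ → begin
          val (s ⊙ t)      ≈⟨ val-⊙ s t ⟩
          val s ∙ val t    ≤⟨ ∙-mono s≲s′ t≲t′ ⟩
          val s′ ∙ val t′  ≈⟨ val-⊙ s′ t′ ⟨
          val (s′ ⊙ t′)    ∎
      ; assoc = λ s t w → begin-equality
          val ((s ⊙ t) ⊙ w)           ≈⟨ val-⊙ (s ⊙ t) w ⟩
          val (s ⊙ t) ∙ val w        ≈⟨ ∙-cong (val-⊙ s t) ≈.refl ⟩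
          val s ∙ val t ∙ val w      ≈⟨ assoc _ _ _ ⟩
          val s ∙ (val t ∙ val w)    ≈⟨ ∙-cong ≈.refl (val-⊙ t w) ⟨
          val s ∙ val (t ⊙ w)        ≈⟨ val-⊙ s (t ⊙ w) ⟨
          val (s ⊙ (t ⊙ w))          ∎
      ; identity =
          (λ s → begin-equality
            val ((u ∷ []) ⊙ s)     ≈⟨ val-⊙ (u ∷ []) s ⟩
            val (u ∷ []) ∙ val s   ≈⟨ ∙-cong val-e ≈.refl ⟩
            e ∙ val s              ≈⟨ proj₁ identity _ ⟩
            val s                  ∎) ,
          (λ s → begin-equality
            val (s ⊙ (u ∷ []))     ≈⟨ val-⊙ s (u ∷ []) ⟩
            val s ∙ val (u ∷ [])   ≈⟨ ∙-cong ≈.refl val-e ⟩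
            val s ∙ e              ≈⟨ proj₂ identity _ ⟩
            val s                  ∎)
      ; zeroˡ = λ s → ≲-trans (proj₁ (val-⊙ [] s)) (zeroˡ _)
      ; zeroʳ = λ s → ≲-trans (proj₁ (val-⊙ s [])) (zeroʳ _)
      ; ∙-distribˡ-∨ = λ s t w → begin
          val (s ⊙ (t ++ w))                    ≈⟨ val-⊙ s (t ++ w) ⟩
          val s ∙ val (t ++ w)                  ≈⟨ ∙-cong ≈.refl (val-++ t w) ⟩
          val s ∙ (val t ∨ val w)               ≤⟨ ∙-distribˡ-∨ _ _ _ ⟩
          val s ∙ val t ∨ val s ∙ val w         ≈⟨ ∨-cong (val-⊙ s t) (val-⊙ s w) ⟨
          val (s ⊙ t) ∨ val (s ⊙ w)             ≈⟨ val-++ (s ⊙ t) (s ⊙ w) ⟨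
          val ((s ⊙ t) ++ (s ⊙ w))              ∎
      ; ∙-distribʳ-∨ = λ s t w → begin
          val ((t ++ w) ⊙ s)                    ≈⟨ val-⊙ (t ++ w) s ⟩
          val (t ++ w) ∙ val s                  ≈⟨ ∙-cong (val-++ t w) ≈.refl ⟩
          (val t ∨ val w) ∙ val s               ≤⟨ ∙-distribʳ-∨ _ _ _ ⟩
          val t ∙ val s ∨ val w ∙ val s         ≈⟨ ∨-cong (val-⊙ t s) (val-⊙ w s) ⟨
          val (t ⊙ s) ∨ val (w ⊙ s)             ≈⟨ val-++ (t ⊙ s) (w ⊙ s) ⟨
          val ((t ⊙ s) ++ (w ⊙ s))              ∎
      }

    private module G = JoinMonoid generated

    generated-selective : Selective G._≈_ G._∙_
    generated-selective s t with selective (val s) (val t)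
    ... | inj₁ _ = inj₁ ≈.refl
    ... | inj₂ _ = inj₂ ≈.refl

    generated-commutative : Commutative _≈_ _∙_ → Commutative G._≈_ G._∙_
    generated-commutative comm s t = begin-equality
      val (s ⊙ t)    ≈⟨ val-⊙ s t ⟩
      val s ∙ val t  ≈⟨ comm _ _ ⟩
      val t ∙ val s  ≈⟨ val-⊙ t s ⟨
      val (t ⊙ s)    ∎

    generated-total : Total _≲_ → Total G._≲_
    generated-total total s t = total (val s) (val t)

    -- The universal property is now tested only on elements of the form `val v`, so it survives the
    -- restriction; `val-⊙` translates the products.
    generated-represents-val : ∀ f {s t w} → Represents f (val s) (val t) (val w) →
                               G.Represents f s t w
    generated-represents-val meet rep v = rep (val v)
    generated-represents-val join rep v = rep (val v)
    generated-represents-val mult {s} {t} rep v =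
      ⇔-trans (mk⇔ (≲-trans (proj₂ (val-⊙ s t))) (≲-trans (proj₁ (val-⊙ s t)))) (rep (val v))
    generated-represents-val under {s} rep v =
      ⇔-trans (mk⇔ (≲-trans (proj₂ (val-⊙ s v))) (≲-trans (proj₁ (val-⊙ s v)))) (rep (val v))
    generated-represents-val over {t = t} rep v =
      ⇔-trans (mk⇔ (≲-trans (proj₂ (val-⊙ v t))) (≲-trans (proj₁ (val-⊙ v t)))) (rep (val v))

    generated-represents : ∀ f {i j k} → Represents f (g i) (g j) (g k) →
                           G.Represents f (i ∷ []) (j ∷ []) (k ∷ [])
    generated-represents f {i} {j} {k} rep = generated-represents-val f
      (represents-resp-≈ f (≈.sym val-[ i ]) (≈.sym val-[ j ]) (≈.sym val-[ k ]) rep)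

    -- Idempotence absorbs a generator that is already present, and commutativity moves a new one to
    -- its place. Hence joins over sublists exhaust all finite joins.
    ∨-subs : ∀ {i is t} → i ∈ is → t ∈ subs is → ∃[ t′ ] (t′ ∈ subs is × g i ∨ val t ≈ val t′)
    ∨-subs {i} {j ∷ is} i∈ t∈ with ∈-++⁻ (subs is) t∈
    ∨-subs {is = _ ∷ is} (here refl) _ | inj₁ t∈ =
      _ , ∈-++⁺ʳ (subs is) (∈-map⁺ _ t∈) , ≈.refl
    ∨-subs (there i∈) _ | inj₁ t∈ =
      let t′ , t′∈ , eq = ∨-subs i∈ t∈ in t′ , ∈-++⁺ˡ t′∈ , eq
    ∨-subs {i} {is = j ∷ is} i∈ t∈ | inj₂ t∈map with ∈-map⁻ _ t∈map
    ∨-subs {i} (here refl) t∈ | inj₂ _ | t , _ , refl =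
      _ , t∈ , (begin-equality
        g i ∨ (g i ∨ val t)  ≈⟨ ∨-assoc _ _ _ ⟨
        (g i ∨ g i) ∨ val t  ≈⟨ ∨-cong (∨-idempotent _) ≈.refl ⟩
        g i ∨ val t          ∎)
    ∨-subs {i} {j ∷ is} (there i∈) _ | inj₂ _ | t , t∈ , refl =
      let t′ , t′∈ , eq = ∨-subs i∈ t∈ in
      j ∷ t′ , ∈-++⁺ʳ (subs is) (∈-map⁺ _ t′∈) , (begin-equality
        g i ∨ (g j ∨ val t)  ≈⟨ ∨-assoc _ _ _ ⟨
        (g i ∨ g j) ∨ val t  ≈⟨ ∨-cong (∨-comm _ _) ≈.refl ⟩
        (g j ∨ g i) ∨ val t  ≈⟨ ∨-assoc _ _ _ ⟩
        g j ∨ (g i ∨ val t)  ≈⟨ ∨-cong ≈.refl eq ⟩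
        g j ∨ val t′         ∎)

    subs-enumerates : ∀ is → (∀ i → i ∈ is) → IsEnumeration (JoinMonoid.setoid generated) (subs is)
    subs-enumerates is ∈is s =
      let t , t∈ , eq = go s in Any.map (λ { refl → eq }) t∈
      where
      go : ∀ s → ∃[ t ] (t ∈ subs is × val s ≈ val t)
      go [] = [] , []∈subs is , ≈.refl
      go (i ∷ s) =
        let t , t∈ , s≈t = go s
            t′ , t′∈ , eq = ∨-subs (∈is i) t∈
        in t′ , t′∈ , ≈.trans (∨-cong ≈.refl s≈t) eq

-- The commutant modulo a negative idempotent.

-- The commutant of a negative idempotent r, ordered by x r ≤ y, with a new
-- bottom; a residuated lattice need not have one, but finite joins do.
module _ {c ℓ} (C : ResiduatedLattice c ℓ) where
  open ResiduatedLattice C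

  module Commutant (r : Carrier) (r≤e : r ≤ e) (r∙r≈r : r ∙ r ≈ r) where

    open ResiduatedLatticeProperties C
    open PosetReasoning poset

    Commutes : Carrier → Set ℓ
    Commutes x = x ∙ r ≈ r ∙ x

    infix 4 _⊑_

    _⊑_ : Rel Carrier ℓ
    x ⊑ y = x ∙ r ≤ y

    ≤⇒⊑ : ∀ {x y} → x ≤ y → x ⊑ y
    ≤⇒⊑ x≤y = ≤-trans (x≤e⇒y∙x≤y _ r≤e) x≤y

    ≈⇒⊑ : ∀ {x y} → x ≈ y → x ⊑ y × y ⊑ x
    ≈⇒⊑ x≈y = ≤⇒⊑ (reflexive x≈y) , ≤⇒⊑ (reflexive (≈.sym x≈y))

    ∙r∙r : ∀ x → x ∙ r ∙ r ≈ x ∙ r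
    ∙r∙r x = ≈.trans (assoc x r r) (∙-congˡ r∙r≈r)

    -- Each of the two steps consumes a factor `r`; idempotence supplies the second one.
    ⊑-trans : ∀ {x y z} → x ⊑ y → y ⊑ z → x ⊑ z
    ⊑-trans {x} {y} {z} x⊑y y⊑z = begin
      x ∙ r      ≈⟨ ∙r∙r x ⟨
      x ∙ r ∙ r  ≤⟨ ∙-monoˡ r x⊑y ⟩
      y ∙ r      ≤⟨ y⊑z ⟩
      z          ∎

    -- Each factor needs its own `r`. Idempotence doubles `r`, and commutation with `u` moves one
    -- copy next to `x`; this is why the carrier is restricted to the commutant.
    ∙-mono-⊑ : ∀ {x y u v} → Commutes u → x ⊑ y → u ⊑ v → x ∙ u ⊑ y ∙ v
    ∙-mono-⊑ {x} {y} {u} {v} ur≈ru x⊑y u⊑v = begin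
      x ∙ u ∙ r        ≈⟨ assoc x u r ⟩
      x ∙ (u ∙ r)      ≈⟨ ∙-congˡ (∙r∙r u) ⟨
      x ∙ (u ∙ r ∙ r)  ≈⟨ ∙-congˡ (∙-congʳ ur≈ru) ⟩
      x ∙ (r ∙ u ∙ r)  ≈⟨ ∙-congˡ (assoc r u r) ⟩
      x ∙ (r ∙ (u ∙ r)) ≈⟨ assoc x r (u ∙ r) ⟨
      x ∙ r ∙ (u ∙ r)  ≤⟨ ∙-mono x⊑y u⊑v ⟩
      y ∙ v            ∎

    ∨-least-⊑ : ∀ {x y z} → x ⊑ z → y ⊑ z → x ∨ y ⊑ z
    ∨-least-⊑ x⊑z y⊑z = ≤-trans (∙-distribʳ-∨-≤ r _ _) (∨-least x⊑z y⊑z)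

    e-commutes : Commutes e
    e-commutes = ≈.trans (identityˡ r) (≈.sym (identityʳ r))

    ∙-commutes : ∀ {x y} → Commutes x → Commutes y → Commutes (x ∙ y)
    ∙-commutes {x} {y} xr≈rx yr≈ry = begin-equality
      x ∙ y ∙ r    ≈⟨ assoc x y r ⟩
      x ∙ (y ∙ r)  ≈⟨ ∙-congˡ yr≈ry ⟩
      x ∙ (r ∙ y)  ≈⟨ assoc x r y ⟨
      x ∙ r ∙ y    ≈⟨ ∙-congʳ xr≈rx ⟩
      r ∙ x ∙ y    ≈⟨ assoc r x y ⟩
      r ∙ (x ∙ y)  ∎

    ∨-commutes : ∀ {x y} → Commutes x → Commutes y → Commutes (x ∨ y)
    ∨-commutes {x} {y} xr≈rx yr≈ry = antisym
      (begin
        (x ∨ y) ∙ r    ≤⟨ ∙-distribʳ-∨-≤ r x y ⟩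
        x ∙ r ∨ y ∙ r  ≈⟨ ∨-cong xr≈rx yr≈ry ⟩
        r ∙ x ∨ r ∙ y  ≤⟨ ∨-least (∙-monoʳ r (x≤x∨y x y)) (∙-monoʳ r (y≤x∨y x y)) ⟩
        r ∙ (x ∨ y)    ∎)
      (begin
        r ∙ (x ∨ y)    ≤⟨ ∙-distribˡ-∨-≤ r x y ⟩
        r ∙ x ∨ r ∙ y  ≈⟨ ∨-cong xr≈rx yr≈ry ⟨
        x ∙ r ∨ y ∙ r  ≤⟨ ∨-least (∙-monoˡ r (x≤x∨y x y)) (∙-monoˡ r (y≤x∨y x y)) ⟩
        (x ∨ y) ∙ r    ∎)

    Carrier⊥ : Set (c ⊔ ℓ)
    Carrier⊥ = Maybe (∃ Commutes)

    infix 4 _⊑⊥_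

    _⊑⊥_ : Rel Carrier⊥ ℓ
    nothing      ⊑⊥ _            = ⊤
    just _       ⊑⊥ nothing      = Empty
    just (x , _) ⊑⊥ just (y , _) = x ⊑ y

    _∨⊥_ _∙⊥_ : Op₂ Carrier⊥
    nothing       ∨⊥ y             = y
    just x        ∨⊥ nothing       = just x
    just (x , cx) ∨⊥ just (y , cy) = just (x ∨ y , ∨-commutes cx cy)
    nothing       ∙⊥ y             = nothing
    just x        ∙⊥ nothing       = nothing
    just (x , cx) ∙⊥ just (y , cy) = just (x ∙ y , ∙-commutes cx cy)

    ⊑⊥-refl : Reflexive _⊑⊥_
    ⊑⊥-refl {nothing} = _
    ⊑⊥-refl {just _}  = ≤⇒⊑ ≤-refl

    ⊑⊥-trans : Transitive _⊑⊥_
    ⊑⊥-trans {nothing} _ _ = _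
    ⊑⊥-trans {just _} {just _} {just _} x⊑y y⊑z = ⊑-trans x⊑y y⊑z

    ∨⊥-supremum : Order.Supremum _⊑⊥_ _∨⊥_
    ∨⊥-supremum nothing y = _ , ⊑⊥-refl {y} , λ _ _ y⊑z → y⊑z
    ∨⊥-supremum (just _) nothing = ≤⇒⊑ ≤-refl , _ , λ _ x⊑z _ → x⊑z
    ∨⊥-supremum (just _) (just _) = ≤⇒⊑ (x≤x∨y _ _) , ≤⇒⊑ (y≤x∨y _ _) ,
      λ { (just _) x⊑z y⊑z → ∨-least-⊑ x⊑z y⊑z }

    ∙⊥-mono : _∙⊥_ Preserves₂ _⊑⊥_ ⟶ _⊑⊥_ ⟶ _⊑⊥_
    ∙⊥-mono {nothing} _ _ = _
    ∙⊥-mono {just _} {just _} {nothing} _ _ = _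
    ∙⊥-mono {just _} {just _} {just (_ , cu)} {just _} x⊑y u⊑v = ∙-mono-⊑ cu x⊑y u⊑v

    joinMonoid : JoinMonoid (c ⊔ ℓ) ℓ
    joinMonoid = record
      { Carrier = Carrier⊥
      ; _≲_ = _⊑⊥_
      ; _∨_ = _∨⊥_
      ; _∙_ = _∙⊥_
      ; ⊥ = nothing
      ; e = just (e , e-commutes)
      ; ≲-refl = λ {x} → ⊑⊥-refl {x}
      ; ≲-trans = λ {x} {y} {z} → ⊑⊥-trans {x} {y} {z}
      ; minimum = _
      ; supremum = ∨⊥-supremum
      ; ∙-mono = λ {x} {y} {u} {v} → ∙⊥-mono {x} {y} {u} {v}
      ; assoc = λ where
          nothing _ _ → _
          (just _) nothing _ → _
          (just _) (just _) nothing → _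
          (just (x , _)) (just (y , _)) (just (z , _)) → ≈⇒⊑ (assoc x y z)
      ; identity =
          (λ { nothing → _ ; (just (x , _)) → ≈⇒⊑ (identityˡ x) }) ,
          (λ { nothing → _ ; (just (x , _)) → ≈⇒⊑ (identityʳ x) })
      ; zeroˡ = _
      ; zeroʳ = λ { nothing → _ ; (just _) → _ }
      ; ∙-distribˡ-∨ = λ where
          nothing _ _ → _
          (just _) nothing z → ⊑⊥-refl {just _ ∙⊥ z}
          (just _) (just _) nothing → ≤⇒⊑ ≤-refl
          (just (x , _)) (just (y , _)) (just (z , _)) → ≤⇒⊑ (∙-distribˡ-∨-≤ x y z)
      ; ∙-distribʳ-∨ = λ where
          x nothing z → ⊑⊥-refl {z ∙⊥ x}
          nothing (just _) nothing → _
          nothing (just _) (just _) → _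
          (just _) (just _) nothing → ≤⇒⊑ ≤-refl
          (just (x , _)) (just (y , _)) (just (z , _)) → ≤⇒⊑ (∙-distribʳ-∨-≤ x y z)
      }

    private module M = JoinMonoid joinMonoid

    selective⊥ : IsConservative C → Selective M._≈_ M._∙_
    selective⊥ sel nothing _ = inj₁ _
    selective⊥ sel (just _) nothing = inj₂ _
    selective⊥ sel (just (x , _)) (just (y , _)) = Sum.map ≈⇒⊑ ≈⇒⊑ (sel x y)

    commutative⊥ : IsCommutative C → Commutative M._≈_ M._∙_
    commutative⊥ comm nothing nothing = _
    commutative⊥ comm nothing (just _) = _
    commutative⊥ comm (just _) nothing = _
    commutative⊥ comm (just (x , _)) (just (y , _)) = ≈⇒⊑ (comm x y)

    total⊥ : IsTotallyOrdered C → Total M._≲_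
    total⊥ total nothing _ = inj₁ _
    total⊥ total (just _) nothing = inj₂ _
    total⊥ total (just (x , _)) (just (y , _)) = Sum.map ≤⇒⊑ ≤⇒⊑ (total x y)

    -- The hypothesis is stated in `C` because the value of `f` itself need not commute with `r`; it
    -- suffices that `z` does and agrees with it modulo `r`.
    represents⊥ : ∀ f {x y z} (cx : Commutes x) (cy : Commutes y) (cz : Commutes z) →
                  ⟦ f ⟧ᵒ C x y ⊑ z × z ⊑ ⟦ f ⟧ᵒ C x y →
                  M.Represents f (just (x , cx)) (just (y , cy)) (just (z , cz))
    represents⊥ meet cx cy cz (∧⊑z , z⊑∧) nothing = mk⇔ _ _
    represents⊥ meet cx cy cz (∧⊑z , z⊑∧) (just _) = mk⇔
      (λ (v⊑x , v⊑y) → ⊑-trans (∧-greatest v⊑x v⊑y) ∧⊑z)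
      (λ v⊑z → let v⊑∧ = ⊑-trans v⊑z z⊑∧ in
        ≤-trans v⊑∧ (x∧y≤x _ _) , ≤-trans v⊑∧ (x∧y≤y _ _))
    represents⊥ join cx cy cz (∨⊑z , z⊑∨) nothing = mk⇔ proj₁ (λ ())
    represents⊥ join cx cy cz (∨⊑z , z⊑∨) (just _) = mk⇔
      (λ (x⊑v , y⊑v) → ⊑-trans z⊑∨ (∨-least-⊑ x⊑v y⊑v))
      (λ z⊑v → let ∨⊑v = ⊑-trans ∨⊑z z⊑v in
        ⊑-trans (≤⇒⊑ (x≤x∨y _ _)) ∨⊑v , ⊑-trans (≤⇒⊑ (y≤x∨y _ _)) ∨⊑v)
    represents⊥ mult cx cy cz (∙⊑z , z⊑∙) nothing = mk⇔ id id
    represents⊥ mult cx cy cz (∙⊑z , z⊑∙) (just _) = mk⇔ (⊑-trans z⊑∙) (⊑-trans ∙⊑z)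
    represents⊥ under cx cy cz (\⊑z , z⊑\) nothing = mk⇔ _ _
    represents⊥ under {x} cx cy cz (\⊑z , z⊑\) (just (v , _)) = mk⇔
      (λ xv⊑y → ⊑-trans (under-intro (≤-trans (reflexive (≈.sym (assoc x v r))) xv⊑y)) \⊑z)
      (λ v⊑z → ≤-trans (reflexive (assoc x v r)) (under-elim (⊑-trans v⊑z z⊑\)))
    represents⊥ over cx cy cz (/⊑z , z⊑/) nothing = mk⇔ _ _
    represents⊥ over {y = y} cx cy cz (/⊑z , z⊑/) (just (v , _)) = mk⇔
      (λ vy⊑x → ⊑-trans (over-intro (≤-trans (reflexive (≈.sym swap)) vy⊑x)) /⊑z)
      (λ v⊑z → ≤-trans (reflexive swap) (over-elim (⊑-trans v⊑z z⊑/)))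
      where
      -- Modulo `r`, the left condition has `r` after `y`, but residuation in `C` requires it next
      -- to `v`.
      swap : v ∙ y ∙ r ≈ v ∙ r ∙ y
      swap = begin-equality
        v ∙ y ∙ r    ≈⟨ assoc v y r ⟩
        v ∙ (y ∙ r)  ≈⟨ ∙-congˡ cy ⟩
        v ∙ (r ∙ y)  ≈⟨ assoc v r y ⟨
        v ∙ r ∙ y    ∎

-- Conjugation in conservative algebras.

module Conjugates (A : ResiduatedLattice c ℓ) where
  open ResiduatedLattice A
  open ResiduatedLatticeProperties A
  open PosetReasoning poset

  Commute Absorbs : Carrier → Carrier → Set _
  Commute x y = x ∙ y ≈ y ∙ x
  Absorbs r x = x ∙ r ≈ r × r ∙ x ≈ r

  absorbs⇒commute : ∀ {r x} → Absorbs r x → Commute x r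
  absorbs⇒commute (xr≈r , rx≈r) = ≈.trans xr≈r (≈.sym rx≈r)

  commute-resp-≈ : ∀ {x r s} → r ≈ s → Commute x r → Commute x s
  commute-resp-≈ {x} {r} {s} r≈s xr≈rx = begin-equality
    x ∙ s ≈⟨ ∙-congˡ r≈s ⟨
    x ∙ r ≈⟨ xr≈rx ⟩
    r ∙ x ≈⟨ ∙-congʳ r≈s ⟩
    s ∙ x ∎

  -- The meet of the usual left and right conjugates of `r` by `x`, cut off at `r` instead of `e`.
  conjugate : Carrier → Carrier → Carrier
  conjugate x r = r ∧ (x \\ (r ∙ x)) ∧ ((x ∙ r) // x)

  conjugate-≤ : ∀ x r → conjugate x r ≤ r
  conjugate-≤ x r = x∧y≤x _ _

  conjugate-fixes : ∀ {x r} → Commute x r → conjugate x r ≈ r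
  conjugate-fixes xr≈rx = antisym (conjugate-≤ _ _)
    (∧-greatest ≤-refl
      (∧-greatest (under-intro (reflexive xr≈rx)) (over-intro (reflexive (≈.sym xr≈rx)))))

  module _ (sel : IsConservative A) where

    -- By idempotence, `x = x x ≤ x y ≤ x`.
    negative-∙ˡ : ∀ {x y} → x ≤ y → y ≤ e → x ∙ y ≈ x
    negative-∙ˡ {x} x≤y y≤e = antisym (x≤e⇒y∙x≤y _ y≤e)
      (≤-trans (reflexive (≈.sym (conservative⇒idempotent sel x))) (∙-monoʳ x x≤y))

    negative-∙ʳ : ∀ {x y} → x ≤ y → y ≤ e → y ∙ x ≈ x
    negative-∙ʳ {x} x≤y y≤e = antisym (x≤e⇒x∙y≤y _ y≤e)
      (≤-trans (reflexive (≈.sym (conservative⇒idempotent sel x))) (∙-monoˡ x x≤y))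

    -- Since `s = s r`, the factor `r` swallows `x`.
    absorbsˡ : ∀ {s r x} → s ≤ r → r ≤ e → r ∙ x ≈ r → s ∙ x ≈ s
    absorbsˡ {s} {r} {x} s≤r r≤e rx≈r = begin-equality
      s ∙ x        ≈⟨ ∙-congʳ (negative-∙ˡ s≤r r≤e) ⟨
      s ∙ r ∙ x    ≈⟨ assoc s r x ⟩
      s ∙ (r ∙ x)  ≈⟨ ∙-congˡ rx≈r ⟩
      s ∙ r        ≈⟨ negative-∙ˡ s≤r r≤e ⟩
      s            ∎

    absorbsʳ : ∀ {s r x} → s ≤ r → r ≤ e → x ∙ r ≈ r → x ∙ s ≈ s
    absorbsʳ {s} {r} {x} s≤r r≤e xr≈r = begin-equality
      x ∙ s        ≈⟨ ∙-congˡ (negative-∙ʳ s≤r r≤e) ⟨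
      x ∙ (r ∙ s)  ≈⟨ assoc x r s ⟨
      x ∙ r ∙ s    ≈⟨ ∙-congʳ xr≈r ⟩
      r ∙ s        ≈⟨ negative-∙ʳ s≤r r≤e ⟩
      s            ∎

    absorbs-antitone : ∀ {s r x} → s ≤ r → r ≤ e → Absorbs r x → Absorbs s x
    absorbs-antitone s≤r r≤e (xr≈r , rx≈r) =
      absorbsʳ s≤r r≤e xr≈r , absorbsˡ s≤r r≤e rx≈r

    -- If `x` and `r` do not commute, one of `x r`, `r x` is `x` and the other is `r`. Put
    -- `s = conjugate x r`. Absorption on one side is inherited from `r`, as `s ≤ r`. On the other
    -- side the product is `s` or `x`; if it were `x`, the bounds `x s ≤ r x` and `s x ≤ x r` would
    -- give `x ≤ r`, and `r ≤ x` follows from `r ≤ e`, so `x = r` would commute with `r` after all.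
    commute⊎conjugate-absorbs : ∀ x {r} → r ≤ e → Commute x r ⊎ Absorbs (conjugate x r) x
    commute⊎conjugate-absorbs x {r} r≤e with sel x r | sel r x
    ... | inj₁ xr≈x | inj₂ rx≈x = inj₁ (≈.trans xr≈x (≈.sym rx≈x))
    ... | inj₂ xr≈r | inj₁ rx≈r = inj₁ (≈.trans xr≈r (≈.sym rx≈r))
    ... | inj₁ xr≈x | inj₁ rx≈r with sel x (conjugate x r)
    ...   | inj₂ xs≈s = inj₂ (xs≈s , absorbsˡ (conjugate-≤ x r) r≤e rx≈r)
    ...   | inj₁ xs≈x = inj₁ (≈.trans xr≈x (≈.trans x≈r (≈.sym rx≈r)))
      where
      x≈r : x ≈ r
      x≈r = antisym
        (begin
          x                  ≈⟨ xs≈x ⟨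
          x ∙ conjugate x r  ≤⟨ under-elim (≤-trans (x∧y≤y _ _) (x∧y≤x _ _)) ⟩
          r ∙ x              ≈⟨ rx≈r ⟩
          r                  ∎)
        (begin r ≈⟨ rx≈r ⟨ r ∙ x ≤⟨ x≤e⇒x∙y≤y x r≤e ⟩ x ∎)
    commute⊎conjugate-absorbs x {r} r≤e | inj₂ xr≈r | inj₂ rx≈x with sel (conjugate x r) x
    ...   | inj₁ sx≈s = inj₂ (absorbsʳ (conjugate-≤ x r) r≤e xr≈r , sx≈s)
    ...   | inj₂ sx≈x = inj₁ (≈.trans xr≈r (≈.trans (≈.sym x≈r) (≈.sym rx≈x)))
      where
      x≈r : x ≈ r
      x≈r = antisym
        (begin
          x                  ≈⟨ sx≈x ⟨
          conjugate x r ∙ x  ≤⟨ over-elim (≤-trans (x∧y≤y _ _) (x∧y≤y _ _)) ⟩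
          x ∙ r              ≈⟨ xr≈r ⟩
          r                  ∎)
        (begin r ≈⟨ xr≈r ⟨ x ∙ r ≤⟨ x≤e⇒y∙x≤y x r≤e ⟩ x ∎)

-- Normalisation and deviation as terms.

conjugateᵗ : Term → Term → Term
conjugateᵗ s r =
  op meet r (op meet (op under s (op mult r s)) (op over (op mult s r) s))

-- In a conservative algebra conjugating by s either fixes r or yields an
-- element absorbing s, which all lower elements do too. Hence the second
-- normalisation by L below cannot destroy commutation with s.
normalise : List Term → Term → Term
normalise [] r = r
normalise (s ∷ L) r = normalise L (conjugateᵗ s (normalise L r))

-- Packs a finite system of equations into one term: modulo any element below its value, the two
-- sides of each pair agree.
deviation : List (Term × Term) → Term
deviation [] = unit
deviation ((s , t) ∷ E) =
  op meet (op meet (op under s t) (op under t s)) (deviation E)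

module TermSemantics
  {c ℓ} (A : ResiduatedLattice c ℓ) (ρ : ℕ → ResiduatedLattice.Carrier A) where

  open ResiduatedLattice A
  open ResiduatedLatticeProperties A
  open Conjugates A

  ⟦_⟧ : Term → Carrier
  ⟦ t ⟧ = ⟦_⟧ᵗ A t ρ

  normalise-≤ : ∀ L r → ⟦ normalise L r ⟧ ≤ ⟦ r ⟧
  normalise-≤ [] r = ≤-refl
  normalise-≤ (s ∷ L) r = ≤-trans (normalise-≤ L _)
    (≤-trans (conjugate-≤ ⟦ s ⟧ _) (normalise-≤ L r))

  -- Ensures that normalising has no effect in the algebra to be embedded, where the deviation is
  -- `e` and commutes with everything.
  normalise-fixes : ∀ {L r} → All (λ s → Commute ⟦ s ⟧ ⟦ r ⟧) L → ⟦ normalise L r ⟧ ≈ ⟦ r ⟧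
  normalise-fixes [] = ≈.refl
  normalise-fixes {s ∷ L} {r} (c ∷ cs) =
    ≈.trans (normalise-fixes (All.map (commute-resp-≈ (≈.sym conj≈r)) cs)) conj≈r
    where
    fixes : ⟦ normalise L r ⟧ ≈ ⟦ r ⟧
    fixes = normalise-fixes cs
    conj≈r : ⟦ conjugateᵗ s (normalise L r) ⟧ ≈ ⟦ r ⟧
    conj≈r = ≈.trans (conjugate-fixes (commute-resp-≈ (≈.sym fixes) c)) fixes

  normalise-commutes : IsConservative A → ∀ L {r} → ⟦ r ⟧ ≤ e →
                       All (λ s → Commute ⟦ s ⟧ ⟦ normalise L r ⟧) L
  normalise-commutes sel [] r≤e = []
  normalise-commutes sel (s ∷ L) {r} r≤e
    with r′≤e ← ≤-trans (normalise-≤ L r) r≤e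
    with commute⊎conjugate-absorbs sel ⟦ s ⟧ r′≤e
  -- Conjugation by `s` changes nothing here, so the second normalisation starts from an element
  -- that already commutes with all of `L`.
  ... | inj₁ c = All.map (commute-resp-≈ (≈.sym fixes)) cs
    where
    cs : All (λ s → Commute ⟦ s ⟧ ⟦ normalise L r ⟧) (s ∷ L)
    cs = c ∷ normalise-commutes sel L r≤e
    fixes : ⟦ normalise (s ∷ L) r ⟧ ≈ ⟦ normalise L r ⟧
    fixes = ≈.trans
      (normalise-fixes (All.map (commute-resp-≈ (≈.sym (conjugate-fixes c))) (All.tail cs)))
      (conjugate-fixes c)
  ... | inj₂ absorbs =
    absorbs⇒commute (absorbs-antitone sel (normalise-≤ L _) conj≤e absorbs)
    ∷ normalise-commutes sel L conj≤e
    where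
    conj≤e : ⟦ conjugateᵗ s (normalise L r) ⟧ ≤ e
    conj≤e = ≤-trans (conjugate-≤ ⟦ s ⟧ _) r′≤e

  deviation≤e : ∀ E → ⟦ deviation E ⟧ ≤ e
  deviation≤e [] = ≤-refl
  deviation≤e (_ ∷ E) = ≤-trans (x∧y≤y _ _) (deviation≤e E)

  deviation-bounds : ∀ {E s t r} → (s , t) ∈ E → r ≤ ⟦ deviation E ⟧ →
                     ⟦ s ⟧ ∙ r ≤ ⟦ t ⟧ × ⟦ t ⟧ ∙ r ≤ ⟦ s ⟧
  deviation-bounds (here refl) r≤ =
    let r≤\ = ≤-trans r≤ (x∧y≤x _ _) in
    under-elim (≤-trans r≤\ (x∧y≤x _ _)) , under-elim (≤-trans r≤\ (x∧y≤y _ _))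
  deviation-bounds {_ ∷ E} (there st∈E) r≤ = deviation-bounds {E} st∈E (≤-trans r≤ (x∧y≤y _ _))

  deviation≈e : ∀ {E} → All (λ (s , t) → ⟦ s ⟧ ≈ ⟦ t ⟧) E → ⟦ deviation E ⟧ ≈ e
  deviation≈e {E} eqs = antisym (deviation≤e E) (go eqs)
    where
    e≤\ : ∀ {x y} → x ≈ y → e ≤ x \\ y
    e≤\ x≈y = under-intro (reflexive (≈.trans (identityʳ _) x≈y))
    go : ∀ {E} → All (λ (s , t) → ⟦ s ⟧ ≈ ⟦ t ⟧) E → e ≤ ⟦ deviation E ⟧
    go [] = ≤-refl
    go (s≈t ∷ eqs) = ∧-greatest (∧-greatest (e≤\ s≈t) (e≤\ (≈.sym s≈t))) (go eqs)

-- Congruence and partial homomorphisms.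

module _ (A : ResiduatedLattice c ℓ) where
  open ResiduatedLattice A
  open ResiduatedLatticeProperties A

  -- Congruence of the residuals is not an axiom but follows from residuation.
  ⟦⟧ᵒ-cong : ∀ f → ⟦ f ⟧ᵒ A Preserves₂ _≈_ ⟶ _≈_ ⟶ _≈_
  ⟦⟧ᵒ-cong meet = ∧-cong
  ⟦⟧ᵒ-cong join = ∨-cong
  ⟦⟧ᵒ-cong mult = ∙-cong
  ⟦⟧ᵒ-cong under x≈y u≈v = antisym (mono x≈y u≈v) (mono (≈.sym x≈y) (≈.sym u≈v))
    where
    mono : ∀ {x y u v} → x ≈ y → u ≈ v → x \\ u ≤ y \\ v
    mono x≈y u≈v = under-intro (≤-trans (∙-monoˡ _ (reflexive (≈.sym x≈y)))
      (≤-trans (under-elim ≤-refl) (reflexive u≈v)))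
  ⟦⟧ᵒ-cong over x≈y u≈v = antisym (mono x≈y u≈v) (mono (≈.sym x≈y) (≈.sym u≈v))
    where
    mono : ∀ {x y u v} → x ≈ y → u ≈ v → x // u ≤ y // v
    mono x≈y u≈v = over-intro (≤-trans (∙-monoʳ _ (reflexive (≈.sym u≈v)))
      (≤-trans (over-elim ≤-refl) (reflexive x≈y)))

-- The finite subset is given as a family `x`, possibly with repetitions; `≈-hom` makes the map on
-- indices well defined on elements.
record IsPartialHom (A D : ResiduatedLattice c ℓ) {I : Set}
                    (x : I → ResiduatedLattice.Carrier A)
                    (g : I → ResiduatedLattice.Carrier D) : Set (c ⊔ ℓ) where
  private
    module A = ResiduatedLattice A
    module D = ResiduatedLattice D
  field
    ≈-hom : ∀ i j → x i A.≈ x j → g i D.≈ g j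
    e-hom : ∀ i → x i A.≈ A.e → g i D.≈ D.e
    ᵒ-hom : ∀ f i j k → ⟦ f ⟧ᵒ A (x i) (x j) A.≈ x k → ⟦ f ⟧ᵒ D (g i) (g j) D.≈ g k

module _ (A : ResiduatedLattice c ℓ) {I : Set} (x : I → ResiduatedLattice.Carrier A) where

  open IsPartialHom

  trivial-partialHom : IsPartialHom A trivial x _
  trivial-partialHom = record
    { ≈-hom = _
    ; e-hom = _
    ; ᵒ-hom = _
    }

  ×ᴿ-partialHom : ∀ {D E} {g h} → IsPartialHom A D x g → IsPartialHom A E x h →
                  IsPartialHom A (D ×ᴿ E) x (λ i → g i , h i)
  ×ᴿ-partialHom {D} {E} {g} {h} g-hom h-hom = record
    { ≈-hom = λ i j eq → ≈-hom g-hom i j eq , ≈-hom h-hom i j eq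
    ; e-hom = λ i eq → e-hom g-hom i eq , e-hom h-hom i eq
    ; ᵒ-hom = λ f i j k eq → ≡.subst (λ v → ResiduatedLattice._≈_ (D ×ᴿ E) v (g k , h k))
        (≡.sym (×ᴿ-⟦⟧ᵒ D E f (g i , h i) (g j , h j)))
        (ᵒ-hom g-hom f i j k eq , ᵒ-hom h-hom f i j k eq)
    }

-- The finite quotient generated by a finite family.

module _ {c ℓ} (C : ResiduatedLattice c ℓ) where
  open ResiduatedLattice C

  module FiniteQuotient (em : ExcludedMiddle ℓ) (conservative : IsConservative C)
    (r : Carrier) (r≤e : r ≤ e) {n : ℕ} (y : Fin n → Carrier)
    (y-commutes : ∀ i → y i ∙ r ≈ r ∙ y i) (u : Fin n) (yu≈e : y u ≈ e) where

    open ResiduatedLatticeProperties C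
    open Commutant C r r≤e (conservative⇒idempotent conservative r)
    private module M = JoinMonoid joinMonoid

    -- The commutant lives at level `c ⊔ ℓ`. Naming elements by lists of indices, lifted to level
    -- `c`, returns `D` to the universe of `C`.
    y⊥ : Lift c (Fin n) → Carrier⊥
    y⊥ (lift i) = just (y i , y-commutes i)

    open Generated joinMonoid (selective⊥ conservative) y⊥ (lift u) (≈⇒⊑ yu≈e)
    private module G = JoinMonoid generated

    generators : List (Lift c (Fin n))
    generators = map lift (allFin n)

    enumerates : IsEnumeration G.setoid (subs generators)
    enumerates = subs-enumerates generators (λ (lift i) → ∈-map⁺ lift (∈-allFin i))

    open FiniteJoinMonoid generated em (subs generators) enumerates

    D : ResiduatedLattice c ℓ
    D = residuatedLattice
    private module D = ResiduatedLattice D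

    D-hasEnumeration : HasEnumeration D
    D-hasEnumeration = subs generators , enumerates

    D-conservative : IsConservative D
    D-conservative = generated-selective

    D-commutative : IsCommutative C → IsCommutative D
    D-commutative comm = generated-commutative (commutative⊥ comm)

    D-total : IsTotallyOrdered C → IsTotallyOrdered D
    D-total total = residuatedLattice-total (generated-total (total⊥ total))

    [_] : Fin n → D.Carrier
    [ i ] = lift i ∷ []

    -- On singletons `val` reduces to `just` of the generator, so `_≲_` unfolds to the inequality in
    -- `C`.
    [-]-reflects-≤ : ∀ i j → [ i ] D.≤ [ j ] → y i ∙ r ≤ y j
    [-]-reflects-≤ i j = Equivalence.from (≲⇔natural {[ i ]} {[ j ]})

    [-]-≈ : ∀ i j → y i ∙ r ≤ y j × y j ∙ r ≤ y i → [ i ] D.≈ [ j ]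
    [-]-≈ i j eq = eq

    [-]-ᵒ : ∀ f i j k → ⟦ f ⟧ᵒ C (y i) (y j) ∙ r ≤ y k × y k ∙ r ≤ ⟦ f ⟧ᵒ C (y i) (y j) →
            ⟦ f ⟧ᵒ D [ i ] [ j ] D.≈ [ k ]
    [-]-ᵒ f i j k eq = represents⇒≈ f {[ i ]} {[ j ]} {[ k ]} (generated-represents f
      (represents⊥ f (y-commutes i) (y-commutes j) (y-commutes k) eq))

-- Valuations and the finite table of equations.

infix 9 _‼_default_

-- A valuation assigns a value to every variable, hence the default beyond the end of the list.
_‼_default_ : {A : Set a} → List A → ℕ → A → A
[]       ‼ _           default d = d
(x ∷ xs) ‼ ℕ.zero      default d = x
(x ∷ xs) ‼ ℕ.suc i     default d = xs ‼ i default d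

‼-toℕ : ∀ {A : Set a} (xs : List A) i {d} → xs ‼ toℕ i default d ≡ lookup xs i
‼-toℕ (x ∷ xs) Fin.zero = refl
‼-toℕ (x ∷ xs) (Fin.suc i) = ‼-toℕ xs i

binaryOps : List BinaryOp
binaryOps = meet ∷ join ∷ mult ∷ under ∷ over ∷ []

∈binaryOps : ∀ f → f ∈ binaryOps
∈binaryOps meet = here refl
∈binaryOps join = there (here refl)
∈binaryOps mult = there (there (here refl))
∈binaryOps under = there (there (there (here refl)))
∈binaryOps over = there (there (there (there (here refl))))

module Atoms (n : ℕ) where

  -- Index zero is reserved for the unit, which the generators must contain; the variables are
  -- shifted by one.
  atom : Fin (ℕ.suc n) → Term
  atom Fin.zero = unit
  atom (Fin.suc i) = var (toℕ i)

  apply : BinaryOp → Term × Term → Term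
  apply f (s , t) = op f s t

  atoms shallowTerms : List Term
  atoms = tabulate atom
  shallowTerms = atoms ++
    cartesianProductWith apply binaryOps (cartesianProduct atoms atoms)

  -- Every equation that can express an equality between atoms or the value of a basic operation at
  -- atoms; those true in the given algebra will form `table`.
  tableEntries : List (Term × Term)
  tableEntries = cartesianProduct shallowTerms atoms

  atom∈atoms : ∀ i → atom i ∈ atoms
  atom∈atoms = ∈-tabulate⁺

  atom-entry : ∀ i j → (atom i , atom j) ∈ tableEntries
  atom-entry i j = ∈-cartesianProduct⁺ (∈-++⁺ˡ (atom∈atoms i)) (atom∈atoms j)

  op-entry : ∀ f i j k → (op f (atom i) (atom j) , atom k) ∈ tableEntries
  op-entry f i j k = ∈-cartesianProduct⁺
    (∈-++⁺ʳ atoms (∈-cartesianProductWith⁺ apply (∈binaryOps f)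
      (∈-cartesianProduct⁺ (atom∈atoms i) (atom∈atoms j))))
    (atom∈atoms k)

-- Separation by finite algebras and the embedding.

module _ {c ℓ} (em : ExcludedMiddle (suc (c ⊔ ℓ)))
  (K : Pred (ResiduatedLattice c ℓ) (c ⊔ ℓ))
  (K⇒conservative : ∀ {C} → K C → IsConservative C)
  -- This form covers all three classes: the finite quotient is conservative and inherits
  -- commutativity and total order.
  (K-closed : ∀ {C D} → K C → IsConservative D → (IsCommutative C → IsCommutative D) →
              (IsTotallyOrdered C → IsTotallyOrdered D) → K D)
  where

  private
    emℓ : ExcludedMiddle ℓ
    emℓ = lowerEM (suc (c ⊔ ℓ)) em

    V : Pred (ResiduatedLattice c ℓ) (suc (c ⊔ ℓ))
    V = VarietyGeneratedBy K

  module _ (A : ResiduatedLattice c ℓ) (A∈V : V A)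
           (n : ℕ) (ρ : ℕ → ResiduatedLattice.Carrier A) where

    open ResiduatedLattice A
    open ResiduatedLatticeProperties A
    open PosetReasoning poset
    open Atoms n
    private module ⟦A⟧ = TermSemantics A ρ

    x : Fin (ℕ.suc n) → Carrier
    x i = ⟦A⟧.⟦ atom i ⟧

    Holds : Term × Term → Set ℓ
    Holds (s , t) = ⟦A⟧.⟦ s ⟧ ≈ ⟦A⟧.⟦ t ⟧

    holds? : ∀ eq → Dec (Holds eq)
    holds? _ = emℓ

    table : List (Term × Term)
    table = filter holds? tableEntries

    normaliser : Term
    normaliser = normalise atoms (deviation table)

    -- All equations of `table` hold in `A`, so the deviation is `e`, which every conjugation by an
    -- atom fixes.
    normaliser≈e : ⟦A⟧.⟦ normaliser ⟧ ≈ e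
    normaliser≈e = ≈.trans (⟦A⟧.normalise-fixes commutes) deviation≈e
      where
      deviation≈e : ⟦A⟧.⟦ deviation table ⟧ ≈ e
      deviation≈e = ⟦A⟧.deviation≈e {table} (all-filter holds? tableEntries)
      commutes : All (λ s → Conjugates.Commute A ⟦A⟧.⟦ s ⟧ ⟦A⟧.⟦ deviation table ⟧) atoms
      commutes = All.universal (λ _ → Conjugates.commute-resp-≈ A (≈.sym deviation≈e)
        (≈.trans (identityʳ _) (≈.sym (identityˡ _)))) atoms

    Separated : (i j : Fin (ℕ.suc n)) → Set (suc (c ⊔ ℓ))
    Separated i j = ∃[ D ] K D × HasEnumeration D ×
      ∃[ g ] IsPartialHom A D x g × ¬ ResiduatedLattice._≤_ D (g i) (g j)

    module _ (C : ResiduatedLattice c ℓ) (C∈K : K C)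
             (σ : ℕ → ResiduatedLattice.Carrier C) where
      private
        module C = ResiduatedLattice C
        module CP = ResiduatedLatticeProperties C
        module ⟦C⟧ = TermSemantics C σ

      -- If the bound fails, the finite quotient of `C` modulo the value of `normaliser` is itself
      -- the separating algebra.
      separated⊎bounded : ∀ i j →
        Separated i j ⊎ ⟦C⟧.⟦ atom i ⟧ C.∙ ⟦C⟧.⟦ normaliser ⟧ C.≤ ⟦C⟧.⟦ atom j ⟧
      separated⊎bounded i j with emℓ {⟦C⟧.⟦ atom i ⟧ C.∙ ⟦C⟧.⟦ normaliser ⟧ C.≤ ⟦C⟧.⟦ atom j ⟧}
      ... | yes bounded = inj₂ bounded
      ... | no ¬bounded = inj₁
        ( Q.D
        , K-closed C∈K Q.D-conservative Q.D-commutative Q.D-total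
        , Q.D-hasEnumeration
        , Q.[_]
        , record
          { ≈-hom = λ i j eq → Q.[-]-≈ i j (bounds (atom-entry i j) eq)
          -- `Fin.zero` indexes the unit, so being equal to `e` is one more equation between atoms.
          ; e-hom = λ i eq → Q.[-]-≈ i Fin.zero (bounds (atom-entry i Fin.zero) eq)
          ; ᵒ-hom = λ f i j k eq → Q.[-]-ᵒ f i j k (bounds (op-entry f i j k) eq)
          }
        , ¬bounded ∘ Q.[-]-reflects-≤ i j)
        where
        deviation≤e : ⟦C⟧.⟦ deviation table ⟧ C.≤ C.e
        deviation≤e = ⟦C⟧.deviation≤e table
        module Q = FiniteQuotient C emℓ (K⇒conservative C∈K) ⟦C⟧.⟦ normaliser ⟧
          (CP.≤-trans (⟦C⟧.normalise-≤ atoms (deviation table)) deviation≤e)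
          (⟦C⟧.⟦_⟧ ∘ atom)
          (λ i → All.lookup (⟦C⟧.normalise-commutes (K⇒conservative C∈K) atoms deviation≤e)
            (atom∈atoms i))
          Fin.zero CP.≈.refl
        bounds : ∀ {s t} → (s , t) ∈ tableEntries → Holds (s , t) →
                 ⟦C⟧.⟦ s ⟧ C.∙ ⟦C⟧.⟦ normaliser ⟧ C.≤ ⟦C⟧.⟦ t ⟧ ×
                 ⟦C⟧.⟦ t ⟧ C.∙ ⟦C⟧.⟦ normaliser ⟧ C.≤ ⟦C⟧.⟦ s ⟧
        bounds st∈ holds = ⟦C⟧.deviation-bounds {table}
          (∈-filter⁺ holds? st∈ holds)
          (⟦C⟧.normalise-≤ atoms (deviation table))

    separate : ∀ i j → Separated i j ⊎ x i ≤ x j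
    -- `Separated` quantifies over algebras, which fixes the level of the excluded middle assumed.
    separate i j with em {Separated i j}
    ... | yes separated = inj₁ separated
    ... | no ¬separated = inj₂ (begin
      x i                       ≈⟨ identityʳ (x i) ⟨
      x i ∙ e                   ≈⟨ ∙-congˡ normaliser≈e ⟨
      x i ∙ ⟦A⟧.⟦ normaliser ⟧  ≤⟨ under-elim (A∈V normaliser
                                     (op meet normaliser (op under (atom i) (atom j)))
                                     valid ρ) ⟩
      x j                       ∎)
      where
      -- s ≤ t is the equation s ≈ s ∧ t.
      valid : ∀ C → K C →
              Satisfies C normaliser (op meet normaliser (op under (atom i) (atom j)))
      valid C C∈K σ = ResiduatedLatticeProperties.under-intro C
        (Sum.[ (λ separated → contradiction separated ¬separated) , id ]
          (separated⊎bounded C C∈K σ i j))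

    -- Order is reflected only on the listed pairs, so that the product can be built one pair at a
    -- time.
    record FiniteSeparation (ps : List (Fin (ℕ.suc n) × Fin (ℕ.suc n))) :
                            Set (suc (c ⊔ ℓ)) where
      field
        D              : ResiduatedLattice c ℓ
        D∈V            : V D
        hasEnumeration : HasEnumeration D
        g              : Fin (ℕ.suc n) → ResiduatedLattice.Carrier D
        isPartialHom   : IsPartialHom A D x g
        reflects-≤     : All (λ (i , j) → ResiduatedLattice._≤_ D (g i) (g j) → x i ≤ x j) ps

    -- A separating algebra for the new pair is added as a factor. The order of a product is
    -- componentwise, so the pairs treated before remain reflected.
    finite-separation : ∀ ps → FiniteSeparation ps
    finite-separation [] = record
      { D = trivial
      ; D∈V = _
      ; hasEnumeration = tt ∷ [] , λ _ → here tt
      ; isPartialHom = trivial-partialHom A x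
      ; reflects-≤ = []
      }
    finite-separation ((i , j) ∷ ps) with separate i j | finite-separation ps
    ... | inj₂ xi≤xj | S = record
      { FiniteSeparation S hiding (reflects-≤)
      ; reflects-≤ = const xi≤xj ∷ FiniteSeparation.reflects-≤ S
      }
    ... | inj₁ (E , E∈K , E-enum , h , h-hom , hi≰hj) | S = record
      { D = E ×ᴿ D
      ; D∈V = λ s t valid → ×ᴿ-satisfies E D s t (valid E E∈K) (D∈V s t valid)
      ; hasEnumeration = ×ᴿ-hasEnumeration E D E-enum hasEnumeration
      ; g = λ i → h i , g i
      ; isPartialHom = ×ᴿ-partialHom A x h-hom isPartialHom
      ; reflects-≤ = (λ h,g≤ → contradiction (proj₁ h,g≤) hi≰hj)
                     ∷ All.map (λ reflects h,g≤ → reflects (proj₂ h,g≤)) reflects-≤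
      }
      where open FiniteSeparation S

  -- Order is reflected on all pairs, and antisymmetry turns this into injectivity.
  variety-FEP : FiniteEmbeddabilityProperty V
  variety-FEP A A∈V B = D , D∈V , hasEnumeration⇒finite emℓ D hasEnumeration , record
    { injection = record
      -- The shift by one skips the index of the unit.
      { to = λ (a , a∈B) → g (Fin.suc (index a∈B))
      ; cong = λ {(a , a∈B)} {(b , b∈B)} a≈b →
          ≈-hom _ _ (≈.trans (x≈ a∈B) (≈.trans a≈b (≈.sym (x≈ b∈B))))
      ; injective = λ {(a , a∈B)} {(b , b∈B)} ga≈gb → antisym
          (reflects a∈B b∈B (DP.reflexive ga≈gb))
          (reflects b∈B a∈B (DP.reflexive (DP.≈.sym ga≈gb)))
      }
    ; preserves-e = λ e∈B → e-hom _ (x≈ e∈B)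
    ; preserves-op = λ f a b a∈B b∈B fab∈B → DP.≈.sym (ᵒ-hom f _ _ _
        (≈.trans (⟦⟧ᵒ-cong A f (x≈ a∈B) (x≈ b∈B)) (≈.sym (x≈ fab∈B))))
    }
    where
    open ResiduatedLattice A
    open ResiduatedLatticeProperties A
    n : ℕ
    n = length B
    pairs : List (Fin (ℕ.suc n) × Fin (ℕ.suc n))
    pairs = cartesianProduct (allFin _) (allFin _)
    ρ : ℕ → Carrier
    ρ i = B ‼ i default e
    open FiniteSeparation (finite-separation A A∈V n ρ pairs)
    open IsPartialHom isPartialHom
    module D = ResiduatedLattice D
    module DP = ResiduatedLatticeProperties D
    open Membership carrierSetoid using () renaming (_∈_ to _∈ᴬ_)
    x≈ : ∀ {a} (a∈B : a ∈ᴬ B) → ρ (toℕ (index a∈B)) ≈ a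
    x≈ a∈B = ≈.trans (≈.reflexive (‼-toℕ B (index a∈B))) (≈.sym (lookup-index a∈B))
    reflects : ∀ {a b} (a∈B : a ∈ᴬ B) (b∈B : b ∈ᴬ B) →
               g (Fin.suc (index a∈B)) D.≤ g (Fin.suc (index b∈B)) → a ≤ b
    reflects a∈B b∈B g≤ = ≤-trans (reflexive (≈.sym (x≈ a∈B))) (≤-trans
      (All.lookup reflects-≤ (∈-cartesianProduct⁺ (∈-allFin _) (∈-allFin _)) g≤)
      (reflexive (x≈ b∈B)))

corollary5p2 : ∀ {c ℓ} → ExcludedMiddle (suc (c ⊔ ℓ)) →
    FiniteEmbeddabilityProperty (ConservativeVariety {c} {ℓ}) ×
    FiniteEmbeddabilityProperty (CommutativeConservativeVariety {c} {ℓ}) ×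
    FiniteEmbeddabilityProperty (SemilinearIdempotentVariety {c} {ℓ})
corollary5p2 em =
  variety-FEP em IsConservative id (λ _ D-cons _ _ → D-cons) ,
  variety-FEP em (λ A → IsCommutative A × IsConservative A) proj₂
    (λ (comm , _) D-cons D-comm _ → D-comm comm , D-cons) ,
  -- This class is defined by idempotence: linearity turns it into conservativity, and the finite
  -- quotient recovers it from conservativity.
  variety-FEP em (λ A → IsTotallyOrdered A × IsIdempotent A)
    (λ {C} (total , idem) →
      ResiduatedLatticeProperties.totallyOrdered∧idempotent⇒conservative C total idem)
    (λ {_} {D} (total , _) D-cons _ D-total →
      D-total total , ResiduatedLatticeProperties.conservative⇒idempotent D D-cons)
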